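{- Let $G$ be an outerplanar graph. Then $\mathrm{pc}_r(G,k)\in O(r^2k)$. That is, there exists an absolute constant $C>0$ such that for every outerplanar graph $G$, every positive integer $r$ and every integer $k$ with $1\le k\le |V(G)|$, one has $\mathrm{pc}_r(G,k)\le C\, r^2 k$.
   Context: All graphs are finite, simple, loopless and undirected. $\mathrm{dist}(u,v)$ is the usual graph distance (number of edges of a shortest path, $+\infty$ if there is none). For an integer $r$, let $\mathrm{Cap}_r(\ell)=\ell$ if $\ell\le r$ and $\mathrm{Cap}_r(\ell)=+\infty$ otherwise. For $A\subseteq V(G)$ and $v\in V(G)$, the $r$-profile of $v$ with respect to $A$ is the function $p_r(v,A):A\to\mathbb N\cup\{+\infty\}$, $a\mapsto \mathrm{Cap}_r(\mathrm{dist}(a,v))$. Let $\mathrm{pc}_r(G,A)=\big|\{p_r(v,A): v\in V(G)\}\setminus\{a\mapsto+\infty\}\big|$ (the number of distinct $r$-profiles with respect to $A$, not counting the constant $+\infty$ profile), and let $\mathrm{pc}_r(G,k)=\max\{\mathrm{pc}_r(G,A): A\subseteq V(G), |A|=k\}$ (the $r$-profile complexity of $G$). -}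

module Defs where

open import Data.Fin.Base as Fin using (Fin; zero; suc; toℕ)
open import Data.Fin.Permutation using (Permutation′; _⟨$⟩ʳ_)
import Data.Fin.Properties as Finₚ
open import Data.Fin.Subset using (Subset; inside; outside; ∣_∣)
open import Data.Fin.Subset.Properties using (_∈?_)
open import Data.List.Base
  using (List; []; _∷_; _++_; map; filter; length; head; upTo; allFin; deduplicate; applyUpTo)
open import Data.List.Extrema.Nat using (max)
open import Data.List.Membership.Propositional using (_∈_)
open import Data.List.Membership.Propositional.Properties
  using (∈-++⁺ˡ; ∈-++⁺ʳ; ∈-map⁺)
import Data.List.Properties as Listₚ
open import Data.List.Relation.Unary.All using (All; all?)
open import Data.List.Relation.Unary.Any using (here; there)
open import Data.Maybe.Base using (Maybe; just; nothing)
import Data.Maybe.Properties as Maybeₚ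
open import Data.Nat.Base
open import Data.Nat.Properties
open import Data.Nat.Induction using (<-rec)
open import Data.Product.Base using (_×_; _,_; ∃-syntax)
import Data.Vec.Base as Vec
open import Data.Bool.Base using (true; false)
open import Function.Base using (_∘_)
open import Level using (0ℓ)
open import Relation.Binary.Core using (Rel)
open import Relation.Binary.Definitions
  using (Decidable; DecidableEquality; Symmetric; Irreflexive)
open import Relation.Binary.PropositionalEquality
open import Relation.Nullary

record Graph (n : ℕ) : Set₁ where
  field
    Adj        : Rel (Fin n) 0ℓ
    adj?       : Decidable Adj
    adj-sym    : Symmetric Adj
    adj-irrefl : Irreflexive _≡_ Adj

open Graph public

-- A plane drawing with every vertex on the outer face is, combinatorially, a
-- drawing in a closed disc with the vertices placed on the boundary circle and
-- the edges drawn as chords.  `π` sends a vertex to its position along the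
-- circle; two chords cross exactly when their ends alternate.  Since `Adj` is
-- symmetric, ranging over ordered pairs a c and b d covers every alternation.

NonCrossing : ∀ {n} → Graph n → Permutation′ n → Set
NonCrossing G π = ∀ {a b c d} → Adj G a c → Adj G b d →
  ¬ (π ⟨$⟩ʳ a Fin.< π ⟨$⟩ʳ b × π ⟨$⟩ʳ b Fin.< π ⟨$⟩ʳ c × π ⟨$⟩ʳ c Fin.< π ⟨$⟩ʳ d)

Outerplanar : ∀ {n} → Graph n → Set
Outerplanar {n} G = ∃[ π ] NonCrossing {n} G π

ℕ∞ : Set
ℕ∞ = Maybe ℕ

pattern fin ℓ = just ℓ
pattern ∞     = nothing

_≟∞_ : DecidableEquality ℕ∞
_≟∞_ = Maybeₚ.≡-dec _≟_

data Walk {n} (G : Graph n) : ℕ → Fin n → Fin n → Set where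
  nil  : ∀ {u} → Walk G zero u u
  cons : ∀ {ℓ u v w} → Adj G u v → Walk G ℓ v w → Walk G (suc ℓ) u w

walk? : ∀ {n} (G : Graph n) ℓ → Decidable (Walk G ℓ)
walk? G zero    u w with u Finₚ.≟ w
... | yes refl = yes nil
... | no  u≢w  = no λ { nil → u≢w refl }
walk? G (suc ℓ) u w with Finₚ.any? (λ v → adj? G u v ×-dec walk? G ℓ v w)
... | yes (v , e , p) = yes (cons e p)
... | no  ¬p          = no λ { (cons e p) → ¬p (_ , e , p) }

-- The least length of a walk.  Only lengths below n are searched;
-- `dist-fin` and `dist-∞` show that nothing is lost.

dist : ∀ {n} → Graph n → Fin n → Fin n → ℕ∞
dist {n} G u v = head (filter (λ ℓ → walk? G ℓ u v) (upTo n))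

private

  vertex : ∀ {n} {G : Graph n} {ℓ u v} → Walk G ℓ u v → Fin (suc ℓ) → Fin n
  vertex {u = u} p          zero    = u
  vertex         (cons _ p) (suc i) = vertex p i

  drop : ∀ {n} {G : Graph n} {ℓ u v} (p : Walk G ℓ u v) i →
         ∃[ m ] (m + toℕ i ≡ ℓ × Walk G m (vertex p i) v)
  drop {ℓ = ℓ} p zero = ℓ , +-identityʳ ℓ , p
  drop (cons _ p) (suc i) with drop p i
  ... | m , eq , q = m , trans (+-suc m (toℕ i)) (cong suc eq) , q

  splice : ∀ {n} {G : Graph n} {ℓ u v} (p : Walk G ℓ u v) i j →
           i Fin.< j → vertex p i ≡ vertex p j →
           ∃[ m ] (m < ℓ × Walk G m u v)
  splice p zero (suc j) _ eq with drop p (suc j)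
  ... | m , m+j≡ℓ , q =
    m , subst (m <_) m+j≡ℓ (m<m+n m z<s) , subst (λ x → Walk _ m x _) (sym eq) q
  splice (cons e p) (suc i) (suc j) (s<s i<j) eq with splice p i j i<j eq
  ... | m , m<ℓ , q = suc m , s<s m<ℓ , cons e q

  shorten : ∀ {n} {G : Graph n} {u v} ℓ → Walk G ℓ u v →
            ∃[ m ] (m < n × Walk G m u v)
  shorten {n} {G} {u} {v} =
    <-rec (λ ℓ → Walk G ℓ u v → ∃[ m ] (m < n × Walk G m u v)) step
    where
    step : ∀ ℓ → (∀ {m} → m < ℓ → Walk G m u v → ∃[ m ] (m < n × Walk G m u v)) →
           Walk G ℓ u v → ∃[ m ] (m < n × Walk G m u v)
    step ℓ rec p with ℓ <? n
    ... | yes ℓ<n = ℓ , ℓ<n , p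
    ... | no  ℓ≮n with Finₚ.pigeonhole (s≤s (≮⇒≥ ℓ≮n)) (vertex p)
    ...   | i , j , i<j , eq with splice p i j i<j eq
    ...     | m , m<ℓ , q = rec m<ℓ q

  module _ {P : ℕ → Set} (P? : ∀ ℓ → Dec (P ℓ)) where

    first : (ℕ → ℕ) → ℕ → ℕ∞
    first f n = head (filter P? (applyUpTo f n))

    first-fin : ∀ f n {d} → first f n ≡ fin d →
                ∃[ i ] (i < n × f i ≡ d × P d × (∀ j → j < i → ¬ P (f j)))
    first-fin f (suc n) eq with P? (f 0)
    first-fin f (suc n) refl | yes p = 0 , z<s , refl , p , λ _ ()
    first-fin f (suc n) eq   | no ¬p with first-fin (f ∘ suc) n eq
    ... | i , i<n , fi≡d , p , least = suc i , s<s i<n , fi≡d , p ,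
      λ { zero _ → ¬p ; (suc j) (s<s j<i) → least j j<i }

    first-∞ : ∀ f n → first f n ≡ ∞ → ∀ i → i < n → ¬ P (f i)
    first-∞ f (suc n) eq i i<n with P? (f 0)
    first-∞ f (suc n) () i i<n | yes p
    first-∞ f (suc n) eq zero    _         | no ¬p = ¬p
    first-∞ f (suc n) eq (suc i) (s<s i<n) | no ¬p = first-∞ (f ∘ suc) n eq i i<n

dist-fin : ∀ {n} (G : Graph n) {u v d} → dist G u v ≡ fin d →
           Walk G d u v × (∀ {ℓ} → Walk G ℓ u v → d ≤ ℓ)
dist-fin {n} G {u} {v} eq with first-fin (λ ℓ → walk? G ℓ u v) (λ ℓ → ℓ) n eq
... | _ , _ , refl , p , least = p , λ q → ≮⇒≥ λ ℓ<d → least _ ℓ<d q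

dist-∞ : ∀ {n} (G : Graph n) {u v} → dist G u v ≡ ∞ → ∀ {ℓ} → ¬ Walk G ℓ u v
dist-∞ {n} G {u} {v} eq p with shorten _ p
... | m , m<n , q = first-∞ (λ ℓ → walk? G ℓ u v) (λ ℓ → ℓ) n eq m m<n q

Cap : ℕ → ℕ∞ → ℕ∞
Cap r ∞       = ∞
Cap r (fin ℓ) with ℓ ≤? r
... | yes _ = fin ℓ
... | no  _ = ∞

elements : ∀ {n} → Subset n → List (Fin n)
elements {n} A = filter (_∈? A) (allFin n)

-- A function A → ℕ∞ is given by the list of its values along `elements A`;
-- for fixed A, equality of functions is equality of these lists.

Profile : Set
Profile = List ℕ∞

_≟ₚ_ : DecidableEquality Profile
_≟ₚ_ = Listₚ.≡-dec _≟∞_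

profile : ∀ {n} → ℕ → Graph n → Fin n → Subset n → Profile
profile r G v A = map (λ a → Cap r (dist G a v)) (elements A)

Constant∞ : Profile → Set
Constant∞ = All (_≡ ∞)

constant∞? : ∀ p → Dec (Constant∞ p)
constant∞? = all? (_≟∞ ∞)

pcₐ : ∀ {n} → ℕ → Graph n → Subset n → ℕ
pcₐ {n} r G A =
  length (filter (¬? ∘ constant∞?)
    (deduplicate _≟ₚ_ (map (λ v → profile r G v A) (allFin n))))

subsets : ∀ n → List (Subset n)
subsets zero    = Vec.[] ∷ []
subsets (suc n) = map (outside Vec.∷_) (subsets n) ++ map (inside Vec.∷_) (subsets n)

subsets-complete : ∀ {n} (A : Subset n) → A ∈ subsets n
subsets-complete Vec.[]            = here refl
subsets-complete (false Vec.∷ A)   = ∈-++⁺ˡ (∈-map⁺ _ (subsets-complete A))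
subsets-complete (true  Vec.∷ A)   = ∈-++⁺ʳ _ (∈-map⁺ _ (subsets-complete A))

-- pc_r(G,k).  There is a subset of size k whenever k ≤ n, so the default
-- value 0 is only ever taken as the maximum of an empty set.
pc : ∀ {n} → ℕ → Graph n → ℕ → ℕ
pc {n} r G k = max 0 (map (pcₐ r G) (filter (λ A → ∣ A ∣ ≟ k) (subsets n)))

{-# OPTIONS --safe #-}

-- Write τ(s,x) = min(dist(s,x), r+1).  If a region of vertices disjoint from A
-- is separated from the rest of the graph by two edges, then the profile of a
-- vertex in it is determined by its τ-values at their four ends; the values at
-- the ends of one edge differ by at most 1, so there are at most
-- c = (3(r+2))² profiles.  The same holds for separation by two vertices.
--
-- Call an interval (u,v) of the circular order uncrossed if no edge leaves it
-- other than through u or v.  An uncrossed interval has a vertex m splitting it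
-- into two uncrossed ones.  Descending from an uncrossed (U,V) into the half
-- that contains A, we stop at a branching interval (u,v), where m ∈ A or both
-- halves meet A.  The zone between (U,V) and (u,v) meets no point of A; the
-- outermost and the innermost edge joining its two sides cut it into five
-- regions as above.  There are O(|A|) branchings, each costing O(c) = O(r²).

module Submission where

open import Defs
open import Data.Bool.Base using (true; false)
open import Data.Empty using (⊥; ⊥-elim)
open import Data.Fin.Base as Fin using (Fin; toℕ; fromℕ<; combine)
open import Data.Fin.Permutation using (Permutation′; _⟨$⟩ʳ_; _⟨$⟩ˡ_; inverseˡ; inverseʳ)
import Data.Fin.Properties as Finₚ
open import Data.Fin.Subset using (Subset; ∣_∣) renaming (_∈_ to _∈ₛ_)
open import Data.Fin.Subset.Properties using (_∈?_; drop-there)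
open import Data.List.Base
  using (List; []; _∷_; _++_; map; filter; length; allFin; tabulate; deduplicate; lookup)
open import Data.List.Extrema.Nat using (argmin; argmax; argmin-all; argmax-all;
  f[argmin]≤f[xs]; f[xs]≤f[argmax]; max≤v⁺)
open import Data.List.Membership.Propositional using (_∈_; find; lose)
open import Data.List.Membership.Propositional.Properties
  using (∈-++⁺ˡ; ∈-++⁺ʳ; ∈-map⁺; ∈-map⁻; ∈-allFin; ∈-filter⁺; ∈-filter⁻; ∈-deduplicate⁻; ∈-lookup)
open import Data.List.Properties
  using (length-++; length-map; length-tabulate; length-filter; map-cong-local)
open import Data.List.Relation.Unary.All as All using (_∷_)
open import Data.List.Relation.Unary.All.Properties using (all-filter) renaming (map⁺ to All-map⁺)
open import Data.List.Relation.Unary.Any as Any using (here; there; any?)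
open import Data.List.Relation.Unary.Any.Properties using (lookup-index)
open import Data.List.Relation.Unary.Unique.Propositional using (Unique)
open import Data.List.Relation.Unary.AllPairs using (_∷_)
open import Data.List.Relation.Unary.Unique.DecPropositional.Properties using (deduplicate-!)
open import Data.Nat.Base
open import Data.Nat.Properties
open import Data.Nat.Solver using (module +-*-Solver)
open import Data.Product.Base using (Σ; _×_; _,_; ∃-syntax; proj₁; proj₂)
open import Data.Sum.Base using (_⊎_; inj₁; inj₂)
import Data.Vec.Base as Vec
open import Function.Base using (_∘_; id; case_of_)
open import Relation.Binary.PropositionalEquality
open import Relation.Nullary
open import Relation.Unary using () renaming (Decidable to Decidable₁)

open +-*-Solver using (solve; _:=_; _:+_; _:*_; _:^_; con)

-- Counting in lists

lookup-injective : ∀ {X : Set} {xs : List X} → Unique xs →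
                   ∀ {i j} → lookup xs i ≡ lookup xs j → i ≡ j
lookup-injective (_ ∷ _)  {Fin.zero}  {Fin.zero}  _  = refl
lookup-injective (x∉ ∷ _) {Fin.zero}  {Fin.suc j} eq = ⊥-elim (All.lookup x∉ (∈-lookup j) eq)
lookup-injective (x∉ ∷ _) {Fin.suc i} {Fin.zero}  eq = ⊥-elim (All.lookup x∉ (∈-lookup i) (sym eq))
lookup-injective (_ ∷ u)  {Fin.suc i} {Fin.suc j} eq = cong Fin.suc (lookup-injective u eq)

unique-⊆⇒length≤ : ∀ {X : Set} {xs ys : List X} → Unique xs →
                   (∀ {x} → x ∈ xs → x ∈ ys) → length xs ≤ length ys
unique-⊆⇒length≤ {xs = xs} {ys} u sub = Finₚ.injective⇒≤ {f = f} f-inj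
  where
  mem : ∀ i → lookup xs i ∈ ys
  mem i = sub (∈-lookup i)
  f : Fin (length xs) → Fin (length ys)
  f i = Any.index (mem i)
  f-inj : ∀ {i j} → f i ≡ f j → i ≡ j
  f-inj {i} {j} eq = lookup-injective u
    (trans (lookup-index (mem i)) (trans (cong (lookup ys) eq) (sym (lookup-index (mem j)))))

count : ∀ {X : Set} {P : X → Set} → Decidable₁ P → List X → ℕ
count P? xs = length (filter P? xs)

count-disjoint : ∀ {X : Set} {P Q R : X → Set} (P? : Decidable₁ P) (Q? : Decidable₁ Q) (R? : Decidable₁ R) →
  (∀ {x} → P x → R x) → (∀ {x} → Q x → R x) → (∀ {x} → P x → ¬ Q x) →
  ∀ xs → count P? xs + count Q? xs ≤ count R? xs
count-disjoint P? Q? R? P⊆R Q⊆R P∩Q []       = z≤n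
count-disjoint P? Q? R? P⊆R Q⊆R P∩Q (x ∷ xs)
  with count-disjoint P? Q? R? P⊆R Q⊆R P∩Q xs | P? x | Q? x | R? x
... | ih | yes px | yes qx | _     = ⊥-elim (P∩Q px qx)
... | ih | yes px | no _   | yes _ = s≤s ih
... | ih | yes px | no _   | no ¬r = ⊥-elim (¬r (P⊆R px))
... | ih | no _   | yes _  | yes _ = ≤-trans (≤-reflexive (+-suc _ _)) (s≤s ih)
... | ih | no _   | yes qx | no ¬r = ⊥-elim (¬r (Q⊆R qx))
... | ih | no _   | no _   | yes _ = m≤n⇒m≤1+n ih
... | ih | no _   | no _   | no _  = ih

count-positive : ∀ {X : Set} {P : X → Set} (P? : Decidable₁ P) {x xs} → x ∈ xs → P x → 1 ≤ count P? xs
count-positive P? {xs = xs} x∈xs px with filter P? xs | ∈-filter⁺ P? x∈xs px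
... | _ ∷ _ | _ = s≤s z≤n

-- Stated for a tabulation by an arbitrary `f`, because the recursion on `B` replaces `f` by
-- `f ∘ Fin.suc`.
count-tabulate : ∀ {X : Set} {P : X → Set} (P? : Decidable₁ P) {m} (B : Subset m) (f : Fin m → X) →
  (∀ {i} → P (f i) → i ∈ₛ B) → (∀ {i} → i ∈ₛ B → P (f i)) → count P? (tabulate f) ≡ ∣ B ∣
count-tabulate P? Vec.[]      f to from = refl
count-tabulate P? (true Vec.∷ B) f to from with P? (f Fin.zero)
... | yes _ = cong suc (count-tabulate P? B (f ∘ Fin.suc) (drop-there ∘ to) (from ∘ Vec.there))
... | no ¬q = ⊥-elim (¬q (from Vec.here))
count-tabulate P? (false Vec.∷ B) f to from with P? (f Fin.zero)
... | yes q = ⊥-elim (case to q of λ ())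
... | no _  = count-tabulate P? B (f ∘ Fin.suc) (drop-there ∘ to) (from ∘ Vec.there)

length-elements : ∀ {n} (A : Subset n) → length (elements A) ≡ ∣ A ∣
length-elements A = count-tabulate (_∈? A) A id id id

-- Vertices in extremal position

module _ {n} (p : Fin n → ℕ) {P : Fin n → Set} (P? : Decidable₁ P) where

  leftmost : ∀ {w} → P w → ∃[ x ] (P x × ∀ {y} → P y → p x ≤ p y)
  -- `w` is the default value of `argmin`; since it satisfies `P`, so does the result.
  leftmost {w} pw = argmin p w ws , argmin-all p pw (all-filter P? (allFin n)) ,
    λ py → All.lookup (f[argmin]≤f[xs] {f = p} w ws) (∈-filter⁺ P? (∈-allFin _) py)
    where ws = filter P? (allFin n)

  rightmost : ∀ {w} → P w → ∃[ x ] (P x × ∀ {y} → P y → p y ≤ p x)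
  rightmost {w} pw = argmax p w ws , argmax-all p pw (all-filter P? (allFin n)) ,
    λ py → All.lookup (f[xs]≤f[argmax] {f = p} w ws) (∈-filter⁺ P? (∈-allFin _) py)
    where ws = filter P? (allFin n)


-- Truncated distances and separators

module TruncatedDistance {n} (G : Graph n) (r : ℕ) where

  truncate : ℕ∞ → ℕ
  truncate ∞       = suc r
  truncate (fin d) = d ⊓ suc r

  τ : Fin n → Fin n → ℕ
  τ s x = truncate (dist G s x)

  τ≤ : ∀ s x → τ s x ≤ suc r
  τ≤ s x with dist G s x
  ... | ∞     = ≤-refl
  ... | fin d = m⊓n≤n d _

  walk⇒τ≤ : ∀ {ℓ s x} → Walk G ℓ s x → τ s x ≤ ℓ
  walk⇒τ≤ {ℓ} {s} {x} w with dist G s x in eq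
  ... | ∞     = ⊥-elim (dist-∞ G eq w)
  ... | fin d = ≤-trans (m⊓n≤m d _) (proj₂ (dist-fin G eq) w)

  τ<⇒walk : ∀ {s x} → τ s x < suc r → Walk G (τ s x) s x
  τ<⇒walk {s} {x} lt with dist G s x in eq
  ... | ∞     = ⊥-elim (<-irrefl refl lt)
  ... | fin d with ⊓-sel d (suc r)
  ...   | inj₁ e = subst (λ m → Walk G m s x) (sym e) (proj₁ (dist-fin G eq))
  ...   | inj₂ e = ⊥-elim (<-irrefl e lt)

  -- A walk from `t` extends by the edge. If `τ t x` is already `r + 1`, the cap on `τ s x`
  -- suffices.
  τ-adj : ∀ {s t} → Adj G s t → ∀ x → τ s x ≤ suc (τ t x)
  τ-adj {s} {t} e x with m≤n⇒m<n∨m≡n (τ≤ t x)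
  ... | inj₁ lt = walk⇒τ≤ (cons e (τ<⇒walk lt))
  ... | inj₂ eq = ≤-trans (τ≤ s x) (subst (λ m → suc r ≤ suc m) (sym eq) (n≤1+n _))

  untruncate : ℕ → ℕ∞
  untruncate t with t ≤? r
  ... | yes _ = fin t
  ... | no  _ = ∞

  -- `Cap r` factors through `τ`, with `r + 1` standing for `∞`. Profiles can therefore be compared
  -- through the natural numbers `τ a x`.
  cap-dist : ∀ s x → Cap r (dist G s x) ≡ untruncate (τ s x)
  cap-dist s x with dist G s x
  ... | ∞     with suc r ≤? r
  ...   | yes q = ⊥-elim (<-irrefl refl q)
  ...   | no _  = refl
  cap-dist s x | fin d with ⊓-sel d (suc r) | d ≤? r
  ... | inj₁ e | yes q rewrite e with d ≤? r
  ...   | yes _ = refl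
  ...   | no ¬q = ⊥-elim (¬q q)
  cap-dist s x | fin d | inj₁ e | no ¬q rewrite e with d ≤? r
  ...   | yes q = ⊥-elim (¬q q)
  ...   | no _  = refl
  cap-dist s x | fin d | inj₂ e | yes q = ⊥-elim (<-irrefl e (≤-<-trans (m⊓n≤m d _) (s≤s q)))
  cap-dist s x | fin d | inj₂ e | no _ rewrite e with suc r ≤? r
  ...   | yes q = ⊥-elim (<-irrefl refl q)
  ...   | no _  = refl

  profile-cong : ∀ {A x y} → (∀ {a} → a ∈ elements A → τ a x ≡ τ a y) → profile r G x A ≡ profile r G y A
  profile-cong {A} {x} {y} eq = map-cong-local (All.tabulate λ {a} a∈ →
    trans (cap-dist a x) (trans (cong untruncate (eq a∈)) (sym (cap-dist a y))))

  _++ʷ_ : ∀ {ℓ m u v w} → Walk G ℓ u v → Walk G m v w → Walk G (ℓ + m) u w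
  nil      ++ʷ q = q
  cons e p ++ʷ q = cons e (p ++ʷ q)

  module _ {X : Fin n → Set} (X? : Decidable₁ X) {S : List (Fin n)}
           (boundary : ∀ {x y} → X x → Adj G x y → X y ⊎ y ∈ S) where

    -- The vertex just before the walk first enters `X` lies outside `X` and has a neighbour in it,
    -- so `boundary` puts it in `S`. The walk is cut there.
    entrance : ∀ {ℓ a x} → ¬ X a → X x → Walk G ℓ a x →
               ∃[ s ] ∃[ i ] ∃[ j ] (s ∈ S × i + j ≡ ℓ × Walk G i a s × Walk G j s x)
    entrance ¬xa xx nil = ⊥-elim (¬xa xx)
    entrance ¬xa xx (cons {v = v} e w) with X? v
    ... | no ¬xv with entrance ¬xv xx w
    ...   | s , i , j , s∈ , eq , w₁ , w₂ = s , suc i , j , s∈ , cong suc eq , cons e w₁ , w₂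
    entrance ¬xa xx (cons e w) | yes xv with boundary xv (adj-sym G e)
    ...   | inj₁ xa = ⊥-elim (¬xa xa)
    ...   | inj₂ s∈ = _ , 0 , _ , s∈ , refl , nil , cons e w

    -- A walk realising `τ a y` below the cap passes through some `s` in `S`. Its tail from `s` to
    -- `y` is exchanged for a walk from `s` to `x` that is no longer.
    τ-determined-≤ : ∀ {a x y} → ¬ X a → X y → (∀ {s} → s ∈ S → τ s x ≡ τ s y) → τ a x ≤ τ a y
    τ-determined-≤ {a} {x} {y} ¬xa xy eq with m≤n⇒m<n∨m≡n (τ≤ a y)
    ... | inj₂ e = ≤-trans (τ≤ a x) (≤-reflexive (sym e))
    ... | inj₁ lt with entrance ¬xa xy (τ<⇒walk lt)
    ...   | s , i , j , s∈ , e , w₁ , w₂ =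
      ≤-trans (walk⇒τ≤ (w₁ ++ʷ τ<⇒walk τs<)) (≤-trans (+-monoʳ-≤ i τs≤) (≤-reflexive e))
      where
      τs≤ : τ s x ≤ j
      τs≤ = ≤-trans (≤-reflexive (eq s∈)) (walk⇒τ≤ w₂)
      -- Being below the cap, `τ s x` is the length of an actual walk.
      τs< : τ s x < suc r
      τs< = ≤-<-trans τs≤ (≤-<-trans (≤-trans (m≤n+m j i) (≤-reflexive e)) lt)

    τ-determined : ∀ {a x y} → ¬ X a → X x → X y → (∀ {s} → s ∈ S → τ s x ≡ τ s y) → τ a x ≡ τ a y
    τ-determined ¬xa xx xy eq = ≤-antisym (τ-determined-≤ ¬xa xy eq) (τ-determined-≤ ¬xa xx (sym ∘ eq))

-- Covers of sets of profiles

module ProfileCover {n} (G : Graph n) (r : ℕ) (A : Subset n) where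

  open TruncatedDistance G r

  -- Repetitions are allowed and `N` is only an upper bound, so unions are concatenations and costs
  -- add up.
  Cover : (Fin n → Set) → ℕ → Set
  Cover X N = ∃[ ps ] (length ps ≤ N × ∀ {x} → X x → profile r G x A ∈ ps)

  cover-⊆ : ∀ {X Y : Fin n → Set} {N} → (∀ {x} → X x → Y x) → Cover Y N → Cover X N
  cover-⊆ X⊆Y (ps , eq , c) = ps , eq , c ∘ X⊆Y

  cover-≤ : ∀ {X : Fin n → Set} {M N} → M ≤ N → Cover X M → Cover X N
  cover-≤ M≤N (ps , ≤M , c) = ps , ≤-trans ≤M M≤N , c

  infixr 5 _∪ᶜ_
  _∪ᶜ_ : ∀ {X Y : Fin n → Set} {M N} → Cover X M → Cover Y N → Cover (λ x → X x ⊎ Y x) (M + N)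
  (ps , ≤M , c) ∪ᶜ (qs , ≤N , d) = ps ++ qs , ≤-trans (≤-reflexive (length-++ ps)) (+-mono-≤ ≤M ≤N) ,
    λ { (inj₁ xx) → ∈-++⁺ˡ (c xx) ; (inj₂ yx) → ∈-++⁺ʳ ps (d yx) }

  cover-point : ∀ v → Cover (_≡ v) 1
  cover-point v = profile r G v A ∷ [] , ≤-refl , λ { refl → here refl }

  cover-∅ : ∀ {X : Fin n → Set} → (∀ {x} → ¬ X x) → Cover X 0
  cover-∅ ¬X = [] , z≤n , λ x → ⊥-elim (¬X x)

  cover-by-code : ∀ {X : Fin n → Set} (X? : Decidable₁ X) {N} (f : Fin n → Fin N) →
    (∀ {x y} → X x → X y → f x ≡ f y → profile r G x A ≡ profile r G y A) → Cover X N
  cover-by-code {X} X? {N} f f-determines =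
    map g (allFin N) , ≤-reflexive (trans (length-map g (allFin N)) (length-tabulate {n = N} id)) , member
    where
    g : Fin N → Profile
    g k with Finₚ.any? (λ x → X? x ×-dec f x Finₚ.≟ k)
    ... | yes (x , _) = profile r G x A
    -- Dummy entry for a code that no vertex of `X` has; it only counts towards the length.
    ... | no _        = []
    g-f : ∀ {x} → X x → profile r G x A ≡ g (f x)
    g-f {x} xx with Finₚ.any? (λ y → X? y ×-dec f y Finₚ.≟ f x)
    ... | yes (y , yy , eq) = f-determines xx yy (sym eq)
    ... | no none           = ⊥-elim (none (x , xx , refl))
    member : ∀ {x} → X x → profile r G x A ∈ map g (allFin N)
    member xx = subst (_∈ map g (allFin N)) (sym (g-f xx)) (∈-map⁺ g (∈-allFin _))

  Link : Fin n → Fin n → Set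
  Link s t = s ≡ t ⊎ Adj G s t

  link-≤ : ∀ {s t} → Link s t → ∀ x → τ s x ≤ suc (τ t x)
  link-≤ (inj₁ refl) x = n≤1+n _
  link-≤ (inj₂ e)    x = τ-adj e x

  link-sym : ∀ {s t} → Link s t → Link t s
  link-sym (inj₁ eq) = inj₁ (sym eq)
  link-sym (inj₂ e)  = inj₂ (adj-sym G e)

  -- Linked vertices have τ-values at most 1 apart, so a second value is stored
  -- as its offset from the first.
  pair-code : ∀ {s t} → Link s t → Fin n → Fin (suc (suc r) * 3)
  pair-code {s} {t} l x = combine (fromℕ< (s≤s (τ≤ s x))) (fromℕ< {suc (τ t x) ∸ τ s x} (s≤s (begin
    suc (τ t x) ∸ τ s x       ≤⟨ ∸-monoˡ-≤ (τ s x) (s≤s (link-≤ (link-sym l) x)) ⟩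
    2 + τ s x ∸ τ s x         ≡⟨ m+n∸n≡m 2 (τ s x) ⟩
    2                         ∎)))
    where open ≤-Reasoning

  -- By `link-≤` the subtraction in the offset is not cut off at zero, so adding `τ s x` back
  -- recovers `τ t x`.
  pair-code-injective : ∀ {s t} (l : Link s t) {x y} → pair-code l x ≡ pair-code l y →
                        τ s x ≡ τ s y × τ t x ≡ τ t y
  pair-code-injective {s} {t} l {x} {y} eq with Finₚ.combine-injective _ _ _ _ eq
  ... | eq₁ , eq₂ = τs , suc-injective (begin
    suc (τ t x)                     ≡⟨ m+[n∸m]≡n (link-≤ l x) ⟨
    τ s x + (suc (τ t x) ∸ τ s x)   ≡⟨ cong₂ _+_ τs (Finₚ.fromℕ<-injective _ _ _ _ eq₂) ⟩
    τ s y + (suc (τ t y) ∸ τ s y)   ≡⟨ m+[n∸m]≡n (link-≤ l y) ⟩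
    suc (τ t y)                     ∎)
    where
    open ≡-Reasoning
    τs = Finₚ.fromℕ<-injective _ _ _ _ eq₁

  c : ℕ
  c = suc (suc r) * 3 * (suc (suc r) * 3)

  1≤c : 1 ≤ c
  1≤c = s≤s z≤n

  cover-region : ∀ {X : Fin n → Set} (X? : Decidable₁ X) {s t s′ t′} → Link s t → Link s′ t′ →
    (∀ {x y} → X x → Adj G x y → X y ⊎ y ∈ s ∷ t ∷ s′ ∷ t′ ∷ []) →
    (∀ {a} → a ∈ elements A → ¬ X a) → Cover X c
  cover-region X? {s} {t} {s′} {t′} l l′ boundary avoids =
    cover-by-code X? (λ x → combine (pair-code l x) (pair-code l′ x)) determined
    where
    determined : ∀ {x y} → _ → _ →
      combine (pair-code l x) (pair-code l′ x) ≡ combine (pair-code l y) (pair-code l′ y) → _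
    determined {x} {y} xx xy eq with Finₚ.combine-injective _ _ _ _ eq
    ... | eq₁ , eq₂ with pair-code-injective l eq₁ | pair-code-injective l′ eq₂
    ...   | e₁ , e₂ | e₃ , e₄ = profile-cong λ a∈ → τ-determined X? boundary (avoids a∈) xx xy
      λ { (here refl) → e₁ ; (there (here refl)) → e₂ ; (there (there (here refl))) → e₃
        ; (there (there (there (here refl)))) → e₄ }

  pcₐ≤ : ∀ {X : Fin n → Set} {N} → (∀ x → X x) → Cover X N → pcₐ r G A ≤ N
  pcₐ≤ all (ps , ≤N , cov) = ≤-trans (length-filter _ (deduplicate _≟ₚ_ profiles)) (≤-trans
    (unique-⊆⇒length≤ (deduplicate-! _≟ₚ_ profiles) λ q∈ → sub (∈-deduplicate⁻ _≟ₚ_ profiles q∈)) ≤N)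
    where
    profiles = map (λ v → profile r G v A) (allFin n)
    sub : ∀ {q} → q ∈ profiles → q ∈ ps
    sub q∈ with ∈-map⁻ _ q∈
    ... | x , _ , refl = cov (all x)

-- Intervals and regions of a circular layout

module CircularLayout {n} (G : Graph n) (p : Fin n → ℕ) (p-injective : ∀ {x y} → p x ≡ p y → x ≡ y)
  (non-crossing : ∀ {a b c d} → Adj G a c → Adj G b d → p a < p b → p b < p c → p c < p d → ⊥)
  (r : ℕ) (A : Subset n) where

  open ProfileCover G r A

  Between : Fin n → Fin n → Fin n → Set
  Between u v x = p u < p x × p x < p v

  between? : ∀ u v → Decidable₁ (Between u v)
  between? u v x = p u <? p x ×-dec p x <? p v

  Uncrossed : Fin n → Fin n → Set
  Uncrossed u v = ∀ {x y} → Between u v x → Adj G x y → p u ≤ p y × p y ≤ p v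

  Avoids : (Fin n → Set) → Set
  Avoids X = ∀ {a} → a ∈ elements A → ¬ X a

  ≤⇒≡⊎< : ∀ {x y} → p x ≤ p y → x ≡ y ⊎ p x < p y
  ≤⇒≡⊎< le with m≤n⇒m<n∨m≡n le
  ... | inj₁ lt = inj₂ lt
  ... | inj₂ eq = inj₁ (p-injective eq)

  cover-between : ∀ {u v} → Uncrossed u v → Avoids (Between u v) → Cover (Between u v) c
  cover-between {u} {v} uv avoids = cover-region (between? u v) (inj₁ refl) (inj₁ refl) boundary avoids
    where
    boundary : ∀ {x y} → Between u v x → Adj G x y → Between u v y ⊎ y ∈ u ∷ u ∷ v ∷ v ∷ []
    boundary x∈ e with uv x∈ e
    ... | u≤y , y≤v with ≤⇒≡⊎< u≤y | ≤⇒≡⊎< y≤v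
    ...   | inj₁ refl | _         = inj₂ (here refl)
    ...   | inj₂ _    | inj₁ refl = inj₂ (there (there (here refl)))
    ...   | inj₂ u<y  | inj₂ y<v  = inj₁ (u<y , y<v)

  -- The two arcs between nested chords `yz` and `y′z′` form one region, as edges may join one arc
  -- to the other.
  Middle : Fin n → Fin n → Fin n → Fin n → Fin n → Set
  Middle y z y′ z′ x = Between y y′ x ⊎ Between z′ z x

  -- An edge leaving the span of `yz` would cross `yz`, and one reaching strictly inside `y′z′`
  -- would cross `y′z′`. The weak inequalities let the two chords share an end or coincide.
  cover-middle : ∀ {y z y′ z′} → Adj G y z → Adj G y′ z′ → p y ≤ p y′ → p y′ < p z′ → p z′ ≤ p z →
                 Avoids (Middle y z y′ z′) → Cover (Middle y z y′ z′) c
  cover-middle {y} {z} {y′} {z′} yz y′z′ y≤y′ y′<z′ z′≤z avoids =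
    cover-region (λ x → between? y y′ x ⊎-dec between? z′ z x) (inj₂ yz) (inj₂ y′z′) boundary avoids
    where
    inside-yz : ∀ {x} → Middle y z y′ z′ x → p y < p x × p x < p z
    inside-yz (inj₁ (y<x , x<y′)) = y<x , <-≤-trans (<-trans x<y′ y′<z′) z′≤z
    inside-yz (inj₂ (z′<x , x<z)) = <-trans (≤-<-trans y≤y′ y′<z′) z′<x , x<z

    between-y′z′ : ∀ {x w} → Middle y z y′ z′ x → Adj G x w → p y′ < p w → ¬ p w < p z′
    between-y′z′ (inj₁ (_ , x<y′)) e y′<w w<z′ = non-crossing e y′z′ x<y′ y′<w w<z′
    between-y′z′ (inj₂ (z′<x , _)) e y′<w w<z′ = non-crossing y′z′ (adj-sym G e) y′<w w<z′ z′<x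

    boundary : ∀ {x w} → Middle y z y′ z′ x → Adj G x w →
               Middle y z y′ z′ w ⊎ w ∈ y ∷ z ∷ y′ ∷ z′ ∷ []
    boundary {x} {w} x∈ e with inside-yz x∈
    ... | y<x , x<z with ≤-<-connex (p y) (p w)
    ... | inj₂ w<y = ⊥-elim (non-crossing (adj-sym G e) yz w<y y<x x<z)
    ... | inj₁ y≤w with ≤-<-connex (p w) (p z)
    ... | inj₂ z<w = ⊥-elim (non-crossing yz e y<x x<z z<w)
    ... | inj₁ w≤z with ≤⇒≡⊎< y≤w | ≤⇒≡⊎< w≤z
    ... | inj₁ refl | _         = inj₂ (here refl)
    ... | inj₂ _    | inj₁ refl = inj₂ (there (here refl))
    ... | inj₂ y<w  | inj₂ w<z  with ≤-<-connex (p y′) (p w)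
    ... | inj₂ w<y′ = inj₁ (inj₁ (y<w , w<y′))
    ... | inj₁ y′≤w with ≤-<-connex (p w) (p z′)
    ... | inj₂ z′<w = inj₁ (inj₂ (z′<w , w<z))
    ... | inj₁ w≤z′ with ≤⇒≡⊎< y′≤w | ≤⇒≡⊎< w≤z′
    ... | inj₁ refl | _         = inj₂ (there (there (here refl)))
    ... | inj₂ _    | inj₁ refl = inj₂ (there (there (there (here refl))))
    ... | inj₂ y′<w | inj₂ w<z′ = ⊥-elim (between-y′z′ x∈ e y′<w w<z′)

  -- The zone between two nested uncrossed intervals

  module Zone {U V u v} (U≤u : p U ≤ p u) (u<v : p u < p v) (v≤V : p v ≤ p V)
    (UV : Uncrossed U V) (uv : Uncrossed u v)
    (inner : ∀ {a} → a ∈ elements A → Between U V a → Between u v a) where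

    avoids-left : ∀ {a} → a ∈ elements A → p U < p a → ¬ p a ≤ p u
    avoids-left a∈ U<a a≤u = <⇒≱ (proj₁ (inner a∈ (U<a , ≤-<-trans a≤u (<-≤-trans u<v v≤V)))) a≤u

    avoids-right : ∀ {a} → a ∈ elements A → p a < p V → ¬ p v ≤ p a
    avoids-right a∈ a<V v≤a = <⇒≱ (proj₂ (inner a∈ (≤-<-trans U≤u (<-≤-trans u<v v≤a) , a<V))) v≤a

    -- Closed at both ends, unlike the zones to be covered: an edge from a zone vertex may end at
    -- `U`, `u`, `v` or `V`, and such edges must compete for being extreme.
    Left Right : Fin n → Set
    Left  y = p U ≤ p y × p y ≤ p u
    Right z = p v ≤ p z × p z ≤ p V

    Left? : Decidable₁ Left
    Left? y = p U ≤? p y ×-dec p y ≤? p u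

    Right? : Decidable₁ Right
    Right? z = p v ≤? p z ×-dec p z ≤? p V

    left<right : ∀ {y z} → Left y → Right z → p y < p z
    left<right (_ , y≤u) (v≤z , _) = ≤-<-trans y≤u (<-≤-trans u<v v≤z)

    LeftEnd RightEnd : Fin n → Set
    LeftEnd  y = Left y × ∃[ z ] (Right z × Adj G y z)
    RightEnd z = Right z × ∃[ y ] (Left y × Adj G y z)

    LeftEnd? : Decidable₁ LeftEnd
    LeftEnd? y = Left? y ×-dec Finₚ.any? (λ z → Right? z ×-dec adj? G y z)

    RightEnd? : Decidable₁ RightEnd
    RightEnd? z = Right? z ×-dec Finₚ.any? (λ y → Left? y ×-dec adj? G y z)

    LeftZone RightZone : Fin n → Set
    LeftZone  = Between U u
    RightZone = Between v V

    -- `UV` keeps `w` within the outer interval. A `w` strictly inside `(u,v)` is excluded because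
    -- `uv` forbids its edge back to `x`.
    left-neighbour : ∀ {x w} → LeftZone x → Adj G x w → p w ≤ p u ⊎ Right w
    left-neighbour {x} {w} (U<x , x<u) e with UV (U<x , <-≤-trans (<-trans x<u u<v) v≤V) e
    ... | U≤w , w≤V with ≤-<-connex (p w) (p u) | <-≤-connex (p w) (p v)
    ... | inj₁ w≤u | _        = inj₁ w≤u
    ... | inj₂ _   | inj₂ v≤w = inj₂ (v≤w , w≤V)
    ... | inj₂ u<w | inj₁ w<v = ⊥-elim (<⇒≱ x<u (proj₁ (uv (u<w , w<v) (adj-sym G e))))

    right-neighbour : ∀ {x w} → RightZone x → Adj G x w → p v ≤ p w ⊎ Left w
    right-neighbour {x} {w} (v<x , x<V) e with UV (≤-<-trans U≤u (<-trans u<v v<x) , x<V) e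
    ... | U≤w , w≤V with ≤-<-connex (p w) (p u) | <-≤-connex (p w) (p v)
    ... | inj₁ w≤u | _        = inj₂ (U≤w , w≤u)
    ... | inj₂ _   | inj₂ v≤w = inj₁ v≤w
    ... | inj₂ u<w | inj₁ w<v = ⊥-elim (<⇒≱ v<x (proj₂ (uv (u<w , w<v) (adj-sym G e))))

    module Crossed {y z y′ z′}
      (ly : Left y) (rz : Right z) (yz : Adj G y z)
      (ly′ : Left y′) (rz′ : Right z′) (y′z′ : Adj G y′ z′)
      (y-least : ∀ {x} → LeftEnd x → p y ≤ p x) (z-greatest : ∀ {x} → RightEnd x → p x ≤ p z)
      (y′-greatest : ∀ {x} → LeftEnd x → p x ≤ p y′) (z′-least : ∀ {x} → RightEnd x → p z′ ≤ p x) where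

      left-of-y : ∀ {x} → Between U y x → LeftZone x
      left-of-y (U<x , x<y) = U<x , <-≤-trans x<y (proj₂ ly)

      right-of-y′ : ∀ {x} → Between y′ u x → LeftZone x
      right-of-y′ (y′<x , x<u) = ≤-<-trans (proj₁ ly′) y′<x , x<u

      left-of-z′ : ∀ {x} → Between v z′ x → RightZone x
      left-of-z′ (v<x , x<z′) = v<x , <-≤-trans x<z′ (proj₂ rz′)

      right-of-z : ∀ {x} → Between z V x → RightZone x
      right-of-z (z<x , x<V) = ≤-<-trans (proj₁ rz) z<x , x<V

      left⇒Left : ∀ {x} → LeftZone x → Left x
      left⇒Left (U<x , x<u) = <⇒≤ U<x , <⇒≤ x<u

      right⇒Right : ∀ {x} → RightZone x → Right x
      right⇒Right (v<x , x<V) = <⇒≤ v<x , <⇒≤ x<V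

      -- The same two arguments serve all four outer arcs `Uy`, `y′u`, `vz′`, `zV`. An edge to the
      -- opposite side would have an end beyond the extreme one; an edge passing over the arc's end
      -- at `yz` or `y′z′` on its own side would cross that chord.
      Uy : Uncrossed U y
      Uy {x} {w} x∈ e = proj₁ (UV (proj₁ x∈ , <-≤-trans (<-trans (proj₂ (left-of-y x∈)) u<v) v≤V) e) , ≮⇒≥ y≮w
        where
        y≮w : ¬ p y < p w
        y≮w y<w with left-neighbour (left-of-y x∈) e
        ... | inj₂ rw  = <⇒≱ (proj₂ x∈) (y-least (left⇒Left (left-of-y x∈) , w , rw , e))
        ... | inj₁ w≤u = non-crossing e yz (proj₂ x∈) y<w (≤-<-trans w≤u (<-≤-trans u<v (proj₁ rz)))

      y′u : Uncrossed y′ u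
      y′u {x} {w} x∈ e = ≮⇒≥ w≮y′ , w≤u
        where
        w≮y′ : ¬ p w < p y′
        w≮y′ w<y′ = non-crossing (adj-sym G e) y′z′ w<y′ (proj₁ x∈) (left<right (left⇒Left (right-of-y′ x∈)) rz′)
        w≤u : p w ≤ p u
        w≤u with left-neighbour (right-of-y′ x∈) e
        ... | inj₁ w≤u = w≤u
        ... | inj₂ rw  = ⊥-elim (<⇒≱ (proj₁ x∈) (y′-greatest (left⇒Left (right-of-y′ x∈) , w , rw , e)))

      vz′ : Uncrossed v z′
      vz′ {x} {w} x∈ e = v≤w , ≮⇒≥ z′≮w
        where
        z′≮w : ¬ p z′ < p w
        z′≮w z′<w = non-crossing y′z′ e (left<right ly′ (right⇒Right (left-of-z′ x∈))) (proj₂ x∈) z′<w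
        v≤w : p v ≤ p w
        v≤w with right-neighbour (left-of-z′ x∈) e
        ... | inj₁ v≤w = v≤w
        ... | inj₂ lw  = ⊥-elim (<⇒≱ (proj₂ x∈) (z′-least (right⇒Right (left-of-z′ x∈) , w , lw , adj-sym G e)))

      zV : Uncrossed z V
      zV {x} {w} x∈ e = ≮⇒≥ w≮z , proj₂ (UV (≤-<-trans U≤u (<-trans u<v (proj₁ (right-of-z x∈))) , proj₂ x∈) e)
        where
        w≮z : ¬ p w < p z
        w≮z w<z with right-neighbour (right-of-z x∈) e
        ... | inj₂ lw  = <⇒≱ (proj₁ x∈) (z-greatest (right⇒Right (right-of-z x∈) , w , lw , adj-sym G e))
        ... | inj₁ v≤w = non-crossing yz (adj-sym G e) (≤-<-trans (proj₂ ly) (<-≤-trans u<v v≤w)) w<z (proj₁ x∈)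

      avoids-middle : Avoids (Middle y z y′ z′)
      avoids-middle a∈ (inj₁ (y<a , a<y′)) =
        avoids-left a∈ (≤-<-trans (proj₁ ly) y<a) (≤-trans (<⇒≤ a<y′) (proj₂ ly′))
      avoids-middle a∈ (inj₂ (z′<a , a<z)) =
        avoids-right a∈ (<-≤-trans a<z (proj₂ rz)) (≤-trans (proj₁ rz′) (<⇒≤ z′<a))

      cover-crossed : Cover (λ x → LeftZone x ⊎ RightZone x)
        (c + (1 + (c + (1 + (c + (c + (1 + (c + 1))))))))
      cover-crossed = cover-⊆ split
        (cover-between Uy (λ a∈ (U<a , a<y) → avoids-left a∈ U<a (<⇒≤ (<-≤-trans a<y (proj₂ ly))))
        ∪ᶜ cover-point y
        ∪ᶜ cover-middle yz y′z′ (y-least (ly′ , z′ , rz′ , y′z′)) (left<right ly′ rz′)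
             (z′-least (rz , y , ly , yz)) avoids-middle
        ∪ᶜ cover-point y′
        ∪ᶜ cover-between y′u (λ a∈ (y′<a , a<u) → avoids-left a∈ (≤-<-trans (proj₁ ly′) y′<a) (<⇒≤ a<u))
        ∪ᶜ cover-between vz′ (λ a∈ (v<a , a<z′) → avoids-right a∈ (<-≤-trans a<z′ (proj₂ rz′)) (<⇒≤ v<a))
        ∪ᶜ cover-point z
        ∪ᶜ cover-between zV (λ a∈ (z<a , a<V) → avoids-right a∈ a<V (<⇒≤ (≤-<-trans (proj₁ rz) z<a)))
        ∪ᶜ cover-point z′)
        where
        split : ∀ {x} → LeftZone x ⊎ RightZone x → _
        split {x} (inj₁ (U<x , x<u)) with <-≤-connex (p x) (p y)
        ... | inj₁ x<y = inj₁ (U<x , x<y)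
        ... | inj₂ y≤x with ≤⇒≡⊎< y≤x
        ... | inj₁ y≡x = inj₂ (inj₁ (sym y≡x))
        ... | inj₂ y<x with <-≤-connex (p x) (p y′)
        ... | inj₁ x<y′ = inj₂ (inj₂ (inj₁ (inj₁ (y<x , x<y′))))
        ... | inj₂ y′≤x with ≤⇒≡⊎< y′≤x
        ... | inj₁ y′≡x = inj₂ (inj₂ (inj₂ (inj₁ (sym y′≡x))))
        ... | inj₂ y′<x = inj₂ (inj₂ (inj₂ (inj₂ (inj₁ (y′<x , x<u)))))
        split {x} (inj₂ (v<x , x<V)) with <-≤-connex (p x) (p z′)
        ... | inj₁ x<z′ = inj₂ (inj₂ (inj₂ (inj₂ (inj₂ (inj₁ (v<x , x<z′))))))
        ... | inj₂ z′≤x with ≤⇒≡⊎< z′≤x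
        ... | inj₁ z′≡x = inj₂ (inj₂ (inj₂ (inj₂ (inj₂ (inj₂ (inj₂ (inj₂ (sym z′≡x))))))))
        ... | inj₂ z′<x with <-≤-connex (p x) (p z)
        ... | inj₁ x<z = inj₂ (inj₂ (inj₁ (inj₂ (z′<x , x<z))))
        ... | inj₂ z≤x with ≤⇒≡⊎< z≤x
        ... | inj₁ z≡x = inj₂ (inj₂ (inj₂ (inj₂ (inj₂ (inj₂ (inj₁ (sym z≡x)))))))
        ... | inj₂ z<x = inj₂ (inj₂ (inj₂ (inj₂ (inj₂ (inj₂ (inj₂ (inj₁ (z<x , x<V))))))))

    -- Five regions and the four ends of the extreme edges cost `5c + 4`, at most `9c` since
    -- `1 ≤ c`.
    cover-zone : Cover (λ x → LeftZone x ⊎ RightZone x) (9 * c)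
    cover-zone with Finₚ.any? LeftEnd?
    -- With no edge joining the sides, each side is an uncrossed interval by itself, at total cost
    -- `2c`.
    ... | no none = cover-≤ (+-monoʳ-≤ c (m≤m+n c _)) (cover-between Uu avoids-l ∪ᶜ cover-between vV avoids-r)
      where
      avoids-l : Avoids LeftZone
      avoids-l a∈ (U<a , a<u) = avoids-left a∈ U<a (<⇒≤ a<u)
      avoids-r : Avoids RightZone
      avoids-r a∈ (v<a , a<V) = avoids-right a∈ a<V (<⇒≤ v<a)
      Uu : Uncrossed U u
      Uu {x} {w} x∈@(U<x , x<u) e with left-neighbour x∈ e
      ... | inj₁ w≤u = proj₁ (UV (U<x , <-≤-trans (<-trans x<u u<v) v≤V) e) , w≤u
      ... | inj₂ rw  = ⊥-elim (none (x , (<⇒≤ U<x , <⇒≤ x<u) , w , rw , e))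
      vV : Uncrossed v V
      vV {x} {w} x∈@(v<x , x<V) e with right-neighbour x∈ e
      ... | inj₁ v≤w = v≤w , proj₂ (UV (≤-<-trans U≤u (<-trans u<v v<x) , x<V) e)
      ... | inj₂ lw  = ⊥-elim (none (w , lw , x , (<⇒≤ v<x , <⇒≤ x<V) , adj-sym G e))
    ... | yes (y₀ , end₀@(l₀ , z₀ , r₀ , e₀))
      with leftmost p LeftEnd? end₀ | rightmost p LeftEnd? end₀
         | leftmost p RightEnd? {z₀} (r₀ , y₀ , l₀ , e₀) | rightmost p RightEnd? {z₀} (r₀ , y₀ , l₀ , e₀)
    ... | y , (ly , z₁ , rz₁ , yz₁) , y-least | y′ , (ly′ , z₂ , rz₂ , y′z₂) , y′-greatest
        | z′ , (rz′ , y₂ , ly₂ , y₂z′) , z′-least | z , (rz , y₁ , ly₁ , y₁z) , z-greatest =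
      cover-≤ (+-monoʳ-≤ c (+-mono-≤ 1≤c (+-monoʳ-≤ c (+-mono-≤ 1≤c (+-monoʳ-≤ c
          (+-monoʳ-≤ c (+-mono-≤ 1≤c (+-monoʳ-≤ c (m≤m+n 1 _)))))))))
        (Crossed.cover-crossed ly rz yz ly′ rz′ y′z′ y-least z-greatest y′-greatest z′-least)
      where
      -- `y` and `z` are chosen independently, each with some partner. If neither partner is the
      -- other extreme, `yz₁` and `y₁z` cross. The same reasoning gives `y′z′`.
      yz : Adj G y z
      yz with ≤⇒≡⊎< (y-least (ly₁ , z , rz , y₁z)) | ≤⇒≡⊎< (z-greatest (rz₁ , y , ly , yz₁))
      ... | inj₁ refl | _         = y₁z
      ... | inj₂ _    | inj₁ refl = yz₁
      ... | inj₂ y<y₁ | inj₂ z₁<z = ⊥-elim (non-crossing yz₁ y₁z y<y₁ (left<right ly₁ rz₁) z₁<z)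
      y′z′ : Adj G y′ z′
      y′z′ with ≤⇒≡⊎< (y′-greatest (ly₂ , z′ , rz′ , y₂z′)) | ≤⇒≡⊎< (z′-least (rz₂ , y′ , ly′ , y′z₂))
      ... | inj₁ refl  | _          = y₂z′
      ... | inj₂ _     | inj₁ refl  = y′z₂
      ... | inj₂ y₂<y′ | inj₂ z′<z₂ = ⊥-elim (non-crossing y₂z′ y′z₂ y₂<y′ (left<right ly′ rz′) z′<z₂)

  -- Splitting intervals and charging the landmarks

  split-interval : ∀ {u v w} → Uncrossed u v → Between u v w →
                   ∃[ m ] (Between u v m × Uncrossed u m × Uncrossed m v)
  split-interval {u} {v} {w} uv w∈ with Finₚ.any? (λ x → between? u v x ×-dec adj? G u x)
  -- Take the furthest inner neighbour `m` of `u`: the chord `um` closes off `(u,m)`, and no vertex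
  -- of `(m,v)` is adjacent to `u`.
  ... | yes (x₀ , end₀) with rightmost p (λ x → between? u v x ×-dec adj? G u x) end₀
  ...   | m , (m∈@(u<m , m<v) , um) , greatest = m , m∈ , left , right
    where
    left : Uncrossed u m
    left (u<x , x<m) e with uv (u<x , <-trans x<m m<v) e
    ... | u≤y , y≤v = u≤y , ≮⇒≥ (non-crossing um e u<x x<m)
    right : Uncrossed m v
    right {x} {y} (m<x , x<v) e with uv (<-trans u<m m<x , x<v) e
    ... | u≤y , y≤v with ≤⇒≡⊎< u≤y
    ...   | inj₁ refl = ⊥-elim (<⇒≱ m<x (greatest ((<-trans u<m m<x , x<v) , adj-sym G e)))
    ...   | inj₂ u<y  = ≮⇒≥ (λ y<m → non-crossing um (adj-sym G e) u<y y<m m<x) , y≤v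
  -- If `u` has no inner neighbour, the first inner vertex works: `(u,m)` is empty and no edge from
  -- `(m,v)` reaches `u`.
  split-interval {u} {v} {w} uv w∈ | no none with leftmost p (between? u v) w∈
  ...   | m , m∈@(u<m , m<v) , least = m , m∈ , left , right
    where
    left : Uncrossed u m
    left (u<x , x<m) e = ⊥-elim (<⇒≱ x<m (least (u<x , <-trans x<m m<v)))
    right : Uncrossed m v
    right {x} {y} (m<x , x<v) e with uv (<-trans u<m m<x , x<v) e
    ... | u≤y , y≤v with ≤⇒≡⊎< u≤y | m≤n⇒m<n∨m≡n y≤v
    ...   | inj₁ refl | _          = ⊥-elim (none (x , (<-trans u<m m<x , x<v) , adj-sym G e))
    ...   | inj₂ u<y  | inj₁ y<v   = least (u<y , y<v) , y≤v
    ...   | inj₂ u<y  | inj₂ py≡pv = subst (p m ≤_) (sym py≡pv) (<⇒≤ m<v) , y≤v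

  landmarks : Fin n → Fin n → ℕ
  landmarks u v = count (between? u v) (elements A)

  Occupied : Fin n → Fin n → Set
  Occupied u v = ∃[ a ] (a ∈ elements A × Between u v a)

  -- The slack 12c pays for the zone around a branching interval whose two
  -- halves are both occupied.
  Bounded : (Fin n → Set) → ℕ → Set
  Bounded X a = ∃[ N ] (Cover X N × N + 12 * c ≤ 26 * c * a)

  -- An interval without landmarks may still cost `c`, which no multiple of its landmark count pays
  -- for; hence the separate case.
  Dichotomy : Fin n → Fin n → Set
  Dichotomy u v =
    (Avoids (Between u v) × Cover (Between u v) c) ⊎
    (Occupied u v × Bounded (Between u v) (landmarks u v))

  dichotomy-cover : ∀ {u v} → Dichotomy u v →
                    ∃[ N ] (Cover (Between u v) N × N ≤ c + 26 * c * landmarks u v)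
  dichotomy-cover (inj₁ (_ , cov))         = c , cov , m≤m+n c _
  dichotomy-cover (inj₂ (_ , N , cov , le)) = N , cov , ≤-trans (m≤m+n N _) (≤-trans le (m≤n+m _ c))

  -- The zone costs `9c`, and the points `u`, `v`, `m` are charged `c` each, whence `12c`.
  branch-cost : ∀ d m → 1 ≤ d → 9 * d + (1 + (1 + (1 + m))) ≤ 12 * d + m
  branch-cost d m 1≤d = begin
    9 * d + (1 + (1 + (1 + m)))         ≤⟨ +-monoʳ-≤ (9 * d) (+-mono-≤ 1≤d (+-mono-≤ 1≤d (+-monoˡ-≤ m 1≤d))) ⟩
    9 * d + (d + (d + (d + m)))         ≡⟨ solve 2
        (λ d m → con 9 :* d :+ (d :+ (d :+ (d :+ m))) := con 12 :* d :+ m)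
        refl d m ⟩
    12 * d + m                          ∎
    where open ≤-Reasoning

  -- The slack of one half pays for the branching; that of the other is passed on.
  branch-occupied : ∀ d a₁ a₂ a {N₁ N₂} → N₁ + 12 * d ≤ 26 * d * a₁ → N₂ + 12 * d ≤ 26 * d * a₂ →
    a₁ + a₂ ≤ a → 12 * d + (N₁ + N₂) + 12 * d ≤ 26 * d * a
  branch-occupied d a₁ a₂ a {N₁} {N₂} le₁ le₂ le = begin
    12 * d + (N₁ + N₂) + 12 * d         ≡⟨ solve 3
        (λ d x y → con 12 :* d :+ (x :+ y) :+ con 12 :* d := (x :+ con 12 :* d) :+ (y :+ con 12 :* d))
        refl d N₁ N₂ ⟩
    (N₁ + 12 * d) + (N₂ + 12 * d)       ≤⟨ +-mono-≤ le₁ le₂ ⟩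
    26 * d * a₁ + 26 * d * a₂           ≡⟨ *-distribˡ-+ (26 * d) a₁ a₂ ⟨
    26 * d * (a₁ + a₂)                  ≤⟨ *-monoʳ-≤ (26 * d) le ⟩
    26 * d * a                          ∎
    where open ≤-Reasoning

  -- The landmark `m` pays for everything, which fixes the constant: 12 for the branching, 12 for
  -- the new slack and 1 for each possibly empty half make 26.
  branch-landmark : ∀ d a₁ a₂ a {N₁ N₂} → N₁ ≤ d + 26 * d * a₁ → N₂ ≤ d + 26 * d * a₂ →
    a₁ + 1 + a₂ ≤ a → 12 * d + (N₁ + N₂) + 12 * d ≤ 26 * d * a
  branch-landmark d a₁ a₂ a {N₁} {N₂} le₁ le₂ le = begin
    12 * d + (N₁ + N₂) + 12 * d                                   ≤⟨ +-monoˡ-≤ (12 * d) (+-monoʳ-≤ (12 * d) (+-mono-≤ le₁ le₂)) ⟩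
    12 * d + (d + 26 * d * a₁ + (d + 26 * d * a₂)) + 12 * d       ≡⟨ solve 3
        (λ d x y → con 12 :* d :+ (d :+ con 26 :* d :* x :+ (d :+ con 26 :* d :* y)) :+ con 12 :* d := con 26 :* d :* (x :+ con 1 :+ y))
        refl d a₁ a₂ ⟩
    26 * d * (a₁ + 1 + a₂)                                        ≤⟨ *-monoʳ-≤ (26 * d) le ⟩
    26 * d * a                                                    ∎
    where open ≤-Reasoning

  landmarks-split : ∀ {u m v} → Between u v m → landmarks u m + landmarks m v ≤ landmarks u v
  landmarks-split {u} {m} {v} (u<m , m<v) = count-disjoint (between? u m) (between? m v) (between? u v)
    (λ (u<x , x<m) → u<x , <-trans x<m m<v) (λ (m<x , x<v) → <-trans u<m m<x , x<v)
    (λ (_ , x<m) (m<x , _) → <-asym x<m m<x) (elements A)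

  landmarks-split-at : ∀ {u m v} → Between u v m → m ∈ elements A →
    landmarks u m + 1 + landmarks m v ≤ landmarks u v
  landmarks-split-at {u} {m} {v} (u<m , m<v) m∈ = ≤-trans
    (+-monoˡ-≤ (landmarks m v) (≤-trans
      (+-monoʳ-≤ (landmarks u m) (count-positive (Finₚ._≟ m) m∈ refl))
      (count-disjoint (between? u m) (Finₚ._≟ m) upto-m?
        (λ (u<x , x<m) → u<x , <⇒≤ x<m) (λ { refl → u<m , ≤-refl })
        (λ { (_ , x<m) refl → <-irrefl refl x<m }) (elements A))))
    (count-disjoint upto-m? (between? m v) (between? u v)
      (λ (u<x , x≤m) → u<x , ≤-<-trans x≤m m<v) (λ (m<x , x<v) → <-trans u<m m<x , x<v)
      (λ (_ , x≤m) (m<x , _) → <⇒≱ m<x x≤m) (elements A))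
    where
    upto-m? : Decidable₁ (λ x → p u < p x × p x ≤ p m)
    upto-m? x = p u <? p x ×-dec p x ≤? p m

  bounded-≤ : ∀ {X} a b → a ≤ b → Bounded X a → Bounded X b
  bounded-≤ a b a≤b (N , cov , le) = N , cov , ≤-trans le (*-monoʳ-≤ (26 * c) a≤b)

  -- The fuel `f` bounds the length of `(u,v)` and makes the mutual recursion terminate:
  -- `cover-nested` lowers it on passing to a half.
  dichotomy : ∀ f {u v} → p v ≤ f + p u → p u < p v → Uncrossed u v → Dichotomy u v

  -- Invariant of the descent: `(U,V)` stays fixed while `(u,v)` shrinks around all its landmarks,
  -- so the zone is paid for only once, at the branching.
  cover-nested : ∀ f {U V u v} → p v ≤ f + p u → p U ≤ p u → p u < p v → p v ≤ p V →
    Uncrossed U V → Uncrossed u v → (∀ {a} → a ∈ elements A → Between U V a → Between u v a) →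
    Occupied u v → Bounded (Between U V) (landmarks u v)

  dichotomy f {u} {v} fuel u<v uv with any? (between? u v) (elements A)
  ... | no none = inj₁ (avoids , cover-between uv avoids)
    where
    avoids : Avoids (Between u v)
    avoids a∈ a∈uv = none (lose a∈ a∈uv)
  ... | yes some = inj₂ (find some , cover-nested f fuel ≤-refl u<v ≤-refl uv uv (λ _ → id) (find some))

  cover-nested zero    fuel U≤u u<v = ⊥-elim (<⇒≱ u<v fuel)
  cover-nested (suc f) {U} {V} {u} {v} fuel U≤u u<v v≤V UV uv inner (a , a∈ , a∈uv)
    with split-interval uv a∈uv
  ... | m , m∈uv@(u<m , m<v) , um , mv = combine-halves
    where
    fuelˡ : p m ≤ f + p u
    fuelˡ = s≤s⁻¹ (≤-trans m<v fuel)
    fuelʳ : p v ≤ f + p m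
    fuelʳ = ≤-trans fuel (≤-trans (≤-reflexive (sym (+-suc f (p u)))) (+-monoʳ-≤ f u<m))

    covered : ∀ {x} → Between U V x →
      (Between U u x ⊎ Between v V x) ⊎ x ≡ u ⊎ x ≡ v ⊎ x ≡ m ⊎ Between u m x ⊎ Between m v x
    covered {x} (U<x , x<V) with <-≤-connex (p x) (p u)
    ... | inj₁ x<u = inj₁ (inj₁ (U<x , x<u))
    ... | inj₂ u≤x with ≤⇒≡⊎< u≤x
    ... | inj₁ u≡x = inj₂ (inj₁ (sym u≡x))
    ... | inj₂ u<x with <-≤-connex (p x) (p v)
    ... | inj₂ v≤x with ≤⇒≡⊎< v≤x
    ...   | inj₁ v≡x = inj₂ (inj₂ (inj₁ (sym v≡x)))
    ...   | inj₂ v<x = inj₁ (inj₂ (v<x , x<V))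
    covered {x} (U<x , x<V) | inj₂ u≤x | inj₂ u<x | inj₁ x<v with <-≤-connex (p x) (p m)
    ... | inj₁ x<m = inj₂ (inj₂ (inj₂ (inj₂ (inj₁ (u<x , x<m)))))
    ... | inj₂ m≤x with ≤⇒≡⊎< m≤x
    ...   | inj₁ m≡x = inj₂ (inj₂ (inj₂ (inj₁ (sym m≡x))))
    ...   | inj₂ m<x = inj₂ (inj₂ (inj₂ (inj₂ (inj₂ (m<x , x<v)))))

    cover-branch : ∀ {N₁ N₂} → Cover (Between u m) N₁ → Cover (Between m v) N₂ →
                   Cover (Between U V) (12 * c + (N₁ + N₂))
    cover-branch {N₁} {N₂} c₁ c₂ = cover-≤ (branch-cost c (N₁ + N₂) 1≤c) (cover-⊆ covered
      (Zone.cover-zone U≤u u<v v≤V UV uv inner ∪ᶜ cover-point u ∪ᶜ cover-point v ∪ᶜ cover-point m ∪ᶜ c₁ ∪ᶜ c₂))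

    innerˡ : ¬ m ∈ elements A → Avoids (Between m v) → ∀ {b} → b ∈ elements A → Between U V b → Between u m b
    innerˡ m∉ right b∈ b∈UV with inner b∈ b∈UV
    ... | u<b , b<v with <-≤-connex (p _) (p m)
    ... | inj₁ b<m = u<b , b<m
    ... | inj₂ m≤b with ≤⇒≡⊎< m≤b
    ... | inj₁ refl = ⊥-elim (m∉ b∈)
    ... | inj₂ m<b  = ⊥-elim (right b∈ (m<b , b<v))

    innerʳ : ¬ m ∈ elements A → Avoids (Between u m) → ∀ {b} → b ∈ elements A → Between U V b → Between m v b
    innerʳ m∉ left b∈ b∈UV with inner b∈ b∈UV
    ... | u<b , b<v with ≤-<-connex (p _) (p m)
    ... | inj₂ m<b = m<b , b<v
    ... | inj₁ b≤m with ≤⇒≡⊎< b≤m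
    ... | inj₁ refl = ⊥-elim (m∉ b∈)
    ... | inj₂ b<m  = ⊥-elim (left b∈ (u<b , b<m))

    a∈UV : Between U V a
    a∈UV = ≤-<-trans U≤u (proj₁ a∈uv) , <-≤-trans (proj₂ a∈uv) v≤V

    combine-halves : Bounded (Between U V) (landmarks u v)
    combine-halves with any? (m Finₚ.≟_) (elements A) | dichotomy f fuelˡ u<m um | dichotomy f fuelʳ m<v mv
    -- A landmark at `m` forces a branching, whether or not the halves are occupied.
    ... | yes m∈ | dˡ | dʳ with dichotomy-cover dˡ | dichotomy-cover dʳ
    ...   | _ , c₁ , le₁ | _ , c₂ , le₂ =
      _ , cover-branch c₁ c₂ ,
      branch-landmark c (landmarks u m) (landmarks m v) (landmarks u v) le₁ le₂ (landmarks-split-at m∈uv m∈)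
    combine-halves | no m∉ | inj₂ (_ , _ , c₁ , le₁) | inj₂ (_ , _ , c₂ , le₂) =
      _ , cover-branch c₁ c₂ ,
      branch-occupied c (landmarks u m) (landmarks m v) (landmarks u v) le₁ le₂ (landmarks-split m∈uv)
    -- The landmark `a` would have no place left.
    combine-halves | no m∉ | inj₁ (left , _) | inj₁ (right , _) =
      ⊥-elim (left a∈ (innerˡ m∉ right a∈ a∈UV))
    -- With one occupied half there is no branching: the descent continues into it at no cost.
    combine-halves | no m∉ | inj₁ (left , _) | inj₂ (occ , _) =
      bounded-≤ (landmarks m v) (landmarks u v) (≤-trans (m≤n+m _ (landmarks u m)) (landmarks-split m∈uv))
        (cover-nested f fuelʳ (≤-trans U≤u (<⇒≤ u<m)) m<v v≤V UV mv (innerʳ m∉ left) occ)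
    combine-halves | no m∉ | inj₂ (occ , _) | inj₁ (right , _) =
      bounded-≤ (landmarks u m) (landmarks u v) (≤-trans (m≤m+n _ (landmarks m v)) (landmarks-split m∈uv))
        (cover-nested f fuelˡ U≤u u<m (≤-trans (<⇒≤ m<v) v≤V) UV um (innerˡ m∉ right) occ)

  -- The bound for the whole graph and the final constant

  pcₐ-bound : ∀ {u v} → (∀ x → p u ≤ p x × p x ≤ p v) → pcₐ r G A ≤ 2 + (c + 26 * c * ∣ A ∣)
  pcₐ-bound {u} {v} extreme = pcₐ≤ id (cover-⊆ (λ {x} _ → covered x) (cover-point u ∪ᶜ cover-point v ∪ᶜ cover-interior))
    where
    covered : ∀ x → x ≡ u ⊎ x ≡ v ⊎ Between u v x
    covered x with ≤⇒≡⊎< (proj₁ (extreme x)) | ≤⇒≡⊎< (proj₂ (extreme x))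
    ... | inj₁ u≡x | _        = inj₁ (sym u≡x)
    ... | inj₂ _   | inj₁ x≡v = inj₂ (inj₁ x≡v)
    ... | inj₂ u<x | inj₂ x<v = inj₂ (inj₂ (u<x , x<v))
    landmarks≤ : landmarks u v ≤ ∣ A ∣
    landmarks≤ = ≤-trans (length-filter (between? u v) (elements A)) (≤-reflexive (length-elements A))
    cover-interior : Cover (Between u v) (c + 26 * c * ∣ A ∣)
    cover-interior with <-≤-connex (p u) (p v)
    -- The extremes coincide: the graph has a single vertex.
    ... | inj₂ v≤u = cover-≤ z≤n (cover-∅ λ (u<x , x<v) → <⇒≱ (<-trans u<x x<v) v≤u)
    -- All positions lie between those of `u` and `v`, so `extreme` itself shows the interval
    -- uncrossed; `p v` is enough fuel.
    ... | inj₁ u<v with dichotomy-cover (dichotomy (p v) (m≤m+n _ _) u<v (λ {x} {y} _ _ → extreme y))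
    ... | _ , cov , le = cover-≤ (≤-trans le (+-monoʳ-≤ c (*-monoʳ-≤ (26 * c) landmarks≤))) cov

-- From `r + 2 ≤ 3r` follows `c ≤ 81r²`. The terms `2`, `c` and `26ck` are at most `2ck`, `ck` and
-- `26ck`, and `29 * 81 = 2349`.
constant-bound : ∀ r k → 1 ≤ r → 1 ≤ k →
  let c = suc (suc r) * 3 * (suc (suc r) * 3) in 2 + (c + 26 * c * k) ≤ 2349 * r ^ 2 * k
constant-bound r k 1≤r 1≤k = begin
  2 + (c + 26 * c * k)                                  ≤⟨ +-mono-≤ 2≤2ck (+-monoˡ-≤ (26 * c * k) c≤ck) ⟩
  2 * (c * k) + (c * k + 26 * c * k)                    ≡⟨ solve 2
        (λ c k → con 2 :* (c :* k) :+ (c :* k :+ con 26 :* c :* k) := con 29 :* c :* k)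
        refl c k ⟩
  29 * c * k                                            ≤⟨ *-monoˡ-≤ k (*-monoʳ-≤ 29 (*-mono-≤ e≤ e≤)) ⟩
  29 * (3 * r * 3 * (3 * r * 3)) * k                    ≡⟨ solve 2
        (λ r k → con 29 :* (con 3 :* r :* con 3 :* (con 3 :* r :* con 3)) :* k := con 2349 :* (r :^ 2) :* k)
        refl r k ⟩
  2349 * r ^ 2 * k                                      ∎
  where
  open ≤-Reasoning
  c : ℕ
  c = suc (suc r) * 3 * (suc (suc r) * 3)
  c≤ck : c ≤ c * k
  c≤ck = m≤m*n c k {{>-nonZero 1≤k}}
  2≤2ck : 2 ≤ 2 * (c * k)
  2≤2ck = *-monoʳ-≤ 2 (≤-trans (s≤s z≤n) c≤ck)
  e≤ : suc (suc r) * 3 ≤ 3 * r * 3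
  e≤ = *-monoˡ-≤ 3 (begin
    2 + r     ≤⟨ +-monoˡ-≤ r (*-monoʳ-≤ 2 1≤r) ⟩
    2 * r + r ≡⟨ +-comm (2 * r) r ⟩
    3 * r     ∎)

module _ {n} (G : Graph (suc n)) (π : Permutation′ (suc n)) (planar : NonCrossing G π) where

  position : Fin (suc n) → ℕ
  position x = toℕ (π ⟨$⟩ʳ x)

  position-injective : ∀ {x y} → position x ≡ position y → x ≡ y
  position-injective eq =
    trans (sym (inverseˡ π)) (trans (cong (π ⟨$⟩ˡ_) (Finₚ.toℕ-injective eq)) (inverseˡ π))

  outerplanar-pcₐ-bound : ∀ r A → pcₐ r G A ≤ 2 + (ProfileCover.c G r A + 26 * ProfileCover.c G r A * ∣ A ∣)
  outerplanar-pcₐ-bound r A = CircularLayout.pcₐ-bound G position position-injective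
    (λ ac bd a<b b<c c<d → planar ac bd (a<b , b<c , c<d)) r A
    {π ⟨$⟩ˡ Fin.zero} {π ⟨$⟩ˡ Fin.fromℕ n} λ x →
      subst (λ i → toℕ i ≤ position x) (sym (inverseʳ π)) z≤n ,
      subst (λ i → position x ≤ toℕ i) (sym (inverseʳ π)) (Finₚ.≤fromℕ (π ⟨$⟩ʳ x))

theorem7 : Σ ℕ λ C → 0 < C ×
    (∀ (n : ℕ) (G : Graph n) → Outerplanar G →
    ∀ (r k : ℕ) → 1 ≤ r → 1 ≤ k → k ≤ n → pc r G k ≤ C * r ^ 2 * k)
theorem7 = 2349 , s≤s z≤n , bound
  where
  bound : ∀ n (G : Graph n) → Outerplanar G → ∀ r k → 1 ≤ r → 1 ≤ k → k ≤ n → pc r G k ≤ 2349 * r ^ 2 * k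
  bound zero    G _            r k 1≤r 1≤k k≤n = ⊥-elim (<⇒≱ 1≤k k≤n)
  -- `z≤n` accounts for the default value `0` of the maximum.
  bound (suc n) G (π , planar) r k 1≤r 1≤k k≤n = max≤v⁺ z≤n (All-map⁺ (All.tabulate bounded))
    where
    bounded : ∀ {A} → A ∈ filter (λ A → ∣ A ∣ ≟ k) (subsets (suc n)) → pcₐ r G A ≤ 2349 * r ^ 2 * k
    bounded {A} A∈ with ∈-filter⁻ (λ A → ∣ A ∣ ≟ k) {xs = subsets (suc n)} A∈
    ... | _ , refl = ≤-trans (outerplanar-pcₐ-bound G π planar r A) (constant-bound r k 1≤r 1≤k)
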